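{- Let $(E,\mathcal L)$ be a simple COM with tope set $\mathcal T$ and tope graph $G$. Then $$\mathcal L=\{X(G')\mid G'\text{ antipodal subgraph of }G\}=\{X(G')\mid G'\text{ antipodal gated subgraph of }G\}=\mathcal L(G),$$ where $\mathcal L(G)=\{X\in\{+,-,0\}^E\mid X\circ(-Y)\in\mathcal T\text{ for all }Y\in\mathcal T\}$. In particular, in the tope graph of a COM all antipodal subgraphs are gated.
   Context: Sign vectors: $E$ finite nonempty, $\emptyset\ne\mathcal L\subseteq\{+,-,0\}^E$; $S(X,Y)=\{e:X_eY_e=-\}$; $(X\circ Y)_e=X_e$ if $X_e\ne0$ else $Y_e$; $(-X)_e=-X_e$. (FS): $X\circ-Y\in\mathcal L$ for all $X,Y\in\mathcal L$. (SE): for $X,Y\in\mathcal L$, $e\in S(X,Y)$ there is $Z\in\mathcal L$ with $Z_e=0$ and $Z_f=(X\circ Y)_f$ for $f\notin S(X,Y)$. A COM satisfies (FS) and (SE). Simple: each coordinate takes all values $+,-,0$ on $\mathcal L$, and for $e\neq f$ there are $X,Y\in\mathcal L$ with $\{X_eX_f,Y_eY_f\}=\{+,-\}$. Topes $\mathcal T=\mathcal L\cap\{+,-\}^E$; the tope graph is the subgraph of the hypercube on $\{+,-\}^E$ induced by $\mathcal T$. For a simple COM the tope graph is an isometric subgraph (partial cube) whose $\Theta$-classes are indexed by $E$: the class of $e$ consists of the edges joining topes that differ exactly in coordinate $e$, and its halfspaces are the topes with $e$-coordinate $+$ resp. $-$. For a convex subgraph $G'$ of $G$, $X(G')\in\{+,-,0\}^E$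 has $X(G')_e=+$ (resp. $-$) if all vertices of $G'$ have $e$-coordinate $+$ (resp. $-$), and $0$ otherwise. A subgraph is convex if it contains all shortest paths between its vertices; $\mathrm{conv}(S)$ is the smallest convex subgraph containing $S$. For a subgraph $H$ and $x\in H$, $-_Hx\in H$ with $\mathrm{conv}(x,-_Hx)=H$ is the antipode of $x$ in $H$; $H$ is antipodal if every vertex has an antipode in $H$. $H$ is gated if for every vertex $x$ of $G$ there is $x'\in H$ such that for every $y\in H$ some shortest $x$–$y$ path passes through $x'$. -}

module Defs where

open import Data.Fin.Base using (Fin)
open import Data.Fin.Properties using (all?; any?) renaming (_≟_ to _≟ᶠ_)
open import Data.Nat.Base using (ℕ; zero; suc; _≤_)
open import Data.Product using (Σ; ∃-syntax; _×_; _,_; proj₁)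
open import Data.Sum using (_⊎_)
open import Data.Vec.Base using (Vec; lookup; map; zipWith)
open import Function using (_∘_)
open import Level using (0ℓ) renaming (suc to lsuc)
open import Relation.Binary.Core using (Rel)
import Relation.Binary.Definitions as B
open import Relation.Binary.PropositionalEquality using (_≡_; _≢_; refl; sym)
open import Relation.Nullary using (¬_; yes; no)
open import Relation.Nullary.Decidable using (¬?; _×-dec_; _→-dec_)
open import Relation.Unary using (Pred; Decidable; Satisfiable; _∈_; _∉_; _⊆_; _∩_; _∪_; ｛_｝)

------------------------------------------------------------------------
-- Sign vectors (the ground set E is Fin n)

data Sign : Set where
  + - 𝟘 : Sign

_≟ˢ_ : B.DecidableEquality Sign
+ ≟ˢ + = yes refl
+ ≟ˢ - = no λ ()
+ ≟ˢ 𝟘 = no λ ()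
- ≟ˢ + = no λ ()
- ≟ˢ - = yes refl
- ≟ˢ 𝟘 = no λ ()
𝟘 ≟ˢ + = no λ ()
𝟘 ≟ˢ - = no λ ()
𝟘 ≟ˢ 𝟘 = yes refl

neg : Sign → Sign
neg + = -
neg - = +
neg 𝟘 = 𝟘

infixl 7 _·_
_·_ : Sign → Sign → Sign
+ · t = t
- · t = neg t
𝟘 · t = 𝟘

_▹_ : Sign → Sign → Sign
+ ▹ _ = +
- ▹ _ = -
𝟘 ▹ t = t

SignVec : ℕ → Set
SignVec n = Vec Sign n

infixr 6 _⊚_
_⊚_ : ∀ {n} → SignVec n → SignVec n → SignVec n
_⊚_ = zipWith _▹_

infix 8 ⊝_
⊝_ : ∀ {n} → SignVec n → SignVec n
⊝_ = map neg

Sep : ∀ {n} → SignVec n → SignVec n → Pred (Fin n) 0ℓ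
Sep X Y e = lookup X e · lookup Y e ≡ -

NoZero : ∀ {n} → Pred (SignVec n) 0ℓ
NoZero X = ∀ e → lookup X e ≢ 𝟘

noZero? : ∀ {n} → Decidable (NoZero {n})
noZero? X = all? λ e → ¬? (lookup X e ≟ˢ 𝟘)

------------------------------------------------------------------------
-- Complexes of oriented matroids

-- Subsets of the finite set of sign vectors are decidable predicates; this is
-- no restriction classically.
record COM (n : ℕ) : Set₁ where
  field
    𝓛        : Pred (SignVec n) 0ℓ
    𝓛?       : Decidable 𝓛
    nonempty : Satisfiable 𝓛
    FS       : ∀ {X Y} → X ∈ 𝓛 → Y ∈ 𝓛 → X ⊚ ⊝ Y ∈ 𝓛
    SE       : ∀ {X Y} → X ∈ 𝓛 → Y ∈ 𝓛 → ∀ {e} → e ∈ Sep X Y →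
               ∃[ Z ] Z ∈ 𝓛 × lookup Z e ≡ 𝟘 ×
                 (∀ f → f ∉ Sep X Y → lookup Z f ≡ lookup (X ⊚ Y) f)

open COM public using (𝓛; 𝓛?)

record Simple {n} (M : COM n) : Set where
  field
    allValues : ∀ e s → ∃[ X ] X ∈ 𝓛 M × lookup X e ≡ s
    separated : ∀ {e f} → e ≢ f →
                ∃[ X ] ∃[ Y ] X ∈ 𝓛 M × Y ∈ 𝓛 M ×
                  lookup X e · lookup X f ≡ + × lookup Y e · lookup Y f ≡ -

𝓣 : ∀ {n} → COM n → Pred (SignVec n) 0ℓ
𝓣 M = 𝓛 M ∩ NoZero

𝓣? : ∀ {n} (M : COM n) → Decidable (𝓣 M)
𝓣? M X = 𝓛? M X ×-dec noZero? X

------------------------------------------------------------------------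
-- Graphs

-- Simple graphs whose vertices are some of the elements of A, so that a
-- subgraph of G : Graph A is again a Graph A.  As G is finite in the application,
-- decidability of V and _~_ is again no restriction classically.
record Graph (A : Set) : Set₁ where
  infix 4 _~_
  field
    V        : Pred A 0ℓ
    V?       : Decidable V
    _~_      : Rel A 0ℓ
    _~?_     : B.Decidable _~_
    ~-sym    : ∀ {x y} → x ~ y → y ~ x
    ~-irrefl : ∀ {x} → ¬ (x ~ x)
    ~-vertex : ∀ {x y} → x ~ y → x ∈ V

open Graph public using (V)

module _ {A : Set} where

  infix 4 _≤ᴳ_
  record _≤ᴳ_ (H G : Graph A) : Set where
    field
      vertices : V H ⊆ V G
      edges    : ∀ {x y} → Graph._~_ H x y → Graph._~_ G x y

  induced : (G : Graph A) (P : Pred A 0ℓ) → Decidable P → Graph A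
  induced G P P? = record
    { V        = V G ∩ P
    ; V?       = λ x → V? x ×-dec P? x
    ; _~_      = λ x y → x ~ y × P x × P y
    ; _~?_     = λ x y → (x ~? y) ×-dec (P? x ×-dec P? y)
    ; ~-sym    = λ (a , p , q) → ~-sym a , q , p
    ; ~-irrefl = λ (a , _) → ~-irrefl a
    ; ~-vertex = λ (a , p , _) → ~-vertex a , p
    }
    where open Graph G using (V?; _~_; _~?_; ~-sym; ~-irrefl; ~-vertex)

  infixr 5 _∷_
  data Walk (G : Graph A) : A → A → Set where
    [_] : ∀ {x} → x ∈ V G → Walk G x x
    _∷_ : ∀ {x y z} → Graph._~_ G x y → Walk G y z → Walk G x z

  length : ∀ {G x y} → Walk G x y → ℕ
  length [ _ ]   = zero
  length (_ ∷ p) = suc (length p)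

  -- A walk of minimum length is automatically a path.
  Shortest : ∀ {G x y} → Walk G x y → Set
  Shortest {G} {x} {y} p = ∀ (q : Walk G x y) → length p ≤ length q

  PassesThrough : ∀ {G x y} → A → Walk G x y → Set
  PassesThrough v ([_] {x} _)   = v ≡ x
  PassesThrough v (_∷_ {x} _ p) = v ≡ x ⊎ PassesThrough v p

  ContainsWalk : ∀ {G x y} → Graph A → Walk G x y → Set
  ContainsWalk H ([_] {x} _)       = x ∈ V H
  ContainsWalk H (_∷_ {x} {y} _ p) = Graph._~_ H x y × ContainsWalk H p

  record Convex (G H : Graph A) : Set where
    field
      subgraph : H ≤ᴳ G
      convex   : ∀ {x y} → x ∈ V H → y ∈ V H →
                 (p : Walk G x y) → Shortest p → ContainsWalk H p

  -- H = conv(S) in G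
  record IsConv (G : Graph A) (S : Pred A 0ℓ) (H : Graph A) : Set₁ where
    field
      convex   : Convex G H
      contains : S ⊆ V H
      smallest : ∀ K → Convex G K → S ⊆ V K → H ≤ᴳ K

  -- Subgraphs are nonempty; without this the empty subgraph would be
  -- vacuously antipodal although its sign vector is undefined.
  record Antipodal (G H : Graph A) : Set₁ where
    field
      subgraph : H ≤ᴳ G
      nonempty : Satisfiable (V H)
      antipode : ∀ {x} → x ∈ V H → ∃[ y ] y ∈ V H × IsConv G (｛ x ｝ ∪ ｛ y ｝) H

  record Gated (G H : Graph A) : Set where
    field
      subgraph : H ≤ᴳ G
      gate     : ∀ {x} → x ∈ V G → ∃[ x′ ] x′ ∈ V H ×
                 (∀ {y} → y ∈ V H → Σ (Walk G x y) λ p → Shortest p × PassesThrough x′ p)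

------------------------------------------------------------------------
-- Tope graphs

module _ {n : ℕ} where

  DifferExactlyAt : Fin n → SignVec n → SignVec n → Set
  DifferExactlyAt e x y = lookup x e ≢ lookup y e × (∀ f → f ≢ e → lookup x f ≡ lookup y f)

  hypercube : Graph (SignVec n)
  hypercube = record
    { V        = NoZero
    ; V?       = noZero?
    ; _~_      = λ x y → NoZero x × NoZero y × ∃[ e ] DifferExactlyAt e x y
    ; _~?_     = λ x y → noZero? x ×-dec (noZero? y ×-dec any? λ e →
                   ¬? (lookup x e ≟ˢ lookup y e) ×-dec
                   all? λ f → ¬? (f ≟ᶠ e) →-dec (lookup x f ≟ˢ lookup y f))
    ; ~-sym    = λ (p , q , e , d , s) → q , p , e , d ∘ sym , λ f f≢e → sym (s f f≢e)
    ; ~-irrefl = λ (_ , _ , _ , d , _) → d refl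
    ; ~-vertex = proj₁
    }

  topeGraph : COM n → Graph (SignVec n)
  topeGraph M = induced hypercube (𝓣 M) (𝓣? M)

  -- X = X(H).  On nonempty H the three clauses are mutually exclusive.
  record IsSignVectorOf (H : Graph (SignVec n)) (X : SignVec n) : Set where
    field
      plus      : ∀ e → (∀ v → v ∈ V H → lookup v e ≡ +) → lookup X e ≡ +
      minus     : ∀ e → (∀ v → v ∈ V H → lookup v e ≡ -) → lookup X e ≡ -
      otherwise : ∀ e → ¬ (∀ v → v ∈ V H → lookup v e ≡ +) →
                        ¬ (∀ v → v ∈ V H → lookup v e ≡ -) → lookup X e ≡ 𝟘

  -- { X(H) | H satisfies P }
  SignVectors : (Graph (SignVec n) → Set₁) → Pred (SignVec n) (lsuc 0ℓ)
  SignVectors P X = ∃[ H ] P H × IsSignVectorOf H X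

  -- 𝓛(G), for G the subgraph of the hypercube induced by V G
  𝓛ᴳ : Graph (SignVec n) → Pred (SignVec n) 0ℓ
  𝓛ᴳ G X = ∀ Y → Y ∈ V G → X ⊚ ⊝ Y ∈ V G

{-# OPTIONS --safe #-}

-- Call a tope T above X if T agrees with X wherever X is nonzero.
-- Everything follows from one criterion: if some tope lies above X, and the
-- topes above X are closed under T ↦ X ∘ (-T), then X is a covector.  Given
-- X ∈ 𝓛(G) the hypothesis is immediate.  Given an antipodal H = conv(x, y), the
-- tope graph being isometric in the hypercube, H consists of all topes that lie
-- above X(H), and the antipode of T in H can only be X(H) ∘ (-T); so X(H) is a
-- covector and the gate of Y in H is X(H) ∘ Y.
--
-- For the criterion, one finds for every set A of zeros of X a covector above X
-- vanishing on A.  By induction there are covectors Uᵉ (e ∈ A) above X vanishing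
-- on A ∖ {e}; we may assume Uᵉₑ ≠ 0.  Choose a tope T above X with Tₑ = Uᵉₑ on A.
-- Starting from X ∘ (-T), eliminating e against Uᵉ changes no coordinate
-- of A but e, so that all of A can be made zero.
module Submission where

open import Data.Bool.Base using (if_then_else_)
open import Data.Fin.Base using (Fin; zero; suc)
open import Data.Fin.Properties using (all?; any?) renaming (_≟_ to _≟ᶠ_)
open import Data.List.Base as List using (List; []; _∷_)
open import Data.List.Membership.Propositional using () renaming (_∈_ to _∈ˡ_)
open import Data.List.Membership.Propositional.Properties
  using (∈-allFin; ∈-filter⁺; ∈-filter⁻)
open import Data.List.Properties using (filter-notAll)
open import Data.List.Relation.Unary.Any as Any using (here; there)
open import Data.Nat.Base using (ℕ; NonZero; zero; suc; _≤_; _<_; z≤n)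
  renaming (_+_ to _+ᴺ_)
open import Data.Nat.Induction using (Acc; acc; <-wellFounded)
open import Data.Nat.Properties as ℕₚ using (module ≤-Reasoning)
open import Algebra.Properties.CommutativeSemigroup ℕₚ.+-commutativeSemigroup
  using (interchange)
open import Data.Product using (Σ; ∃-syntax; _×_; _,_; proj₁; proj₂)
open import Data.Sum using (_⊎_; inj₁; inj₂; [_,_]′)
open import Data.Vec.Base using ([]; _∷_; lookup; tabulate)
open import Data.Vec.Properties
  using (lookup-zipWith; lookup-map; lookup∘tabulate; tabulate∘lookup; tabulate-cong)
open import Function using (_∘_)
open import Relation.Binary.PropositionalEquality
  using (_≡_; _≢_; refl; sym; trans; cong; cong₂; subst; module ≡-Reasoning)
open import Relation.Nullary using (¬_; yes; no; does; contradiction)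
open import Relation.Nullary.Decidable using (¬?; _×-dec_; _⊎-dec_; decidable-stable)
open import Relation.Unary using (Decidable; _∈_; _∉_; _≐_; ｛_｝; _∪_)
open import Defs

-- Signs

neg≡𝟘 : ∀ {s} → neg s ≡ 𝟘 → s ≡ 𝟘
neg≡𝟘 {𝟘} _ = refl

▹-nonzeroˡ : ∀ {s} t → s ≢ 𝟘 → s ▹ t ≡ s
▹-nonzeroˡ {+} _ _  = refl
▹-nonzeroˡ { - } _ _ = refl
▹-nonzeroˡ {𝟘} _ nz = contradiction refl nz

▹-nonzero : ∀ s {t} → t ≢ 𝟘 → s ▹ t ≢ 𝟘
▹-nonzero 𝟘 nz = nz

▹-idem : ∀ s → s ▹ s ≡ s
▹-idem + = refl
▹-idem - = refl
▹-idem 𝟘 = refl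

▹-identityʳ : ∀ s → s ▹ 𝟘 ≡ s
▹-identityʳ + = refl
▹-identityʳ - = refl
▹-identityʳ 𝟘 = refl

▹-neg-neg : ∀ s t → s ▹ neg (s ▹ neg t) ≡ s ▹ t
▹-neg-neg + _ = refl
▹-neg-neg - _ = refl
▹-neg-neg 𝟘 + = refl
▹-neg-neg 𝟘 - = refl
▹-neg-neg 𝟘 𝟘 = refl

neg-apart : ∀ {s} → s ≢ 𝟘 → s ≢ neg s
neg-apart {𝟘} nz _ = nz refl

apart⇒neg : ∀ {s t} → s ≢ 𝟘 → t ≢ 𝟘 → s ≢ t → t ≡ neg s
apart⇒neg {+} {+} _ _ s≢t = contradiction refl s≢t
apart⇒neg {+} { - } _ _ _ = refl
apart⇒neg { - } {+} _ _ _ = refl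
apart⇒neg { - } { - } _ _ s≢t = contradiction refl s≢t
apart⇒neg {𝟘} nz _ _ = contradiction refl nz
apart⇒neg {_} {𝟘} _ nz _ = contradiction refl nz

two-nonzero : ∀ {s t u} → s ≢ 𝟘 → t ≢ 𝟘 → u ≢ 𝟘 → s ≢ t → u ≡ s ⊎ u ≡ t
two-nonzero {s} {t} {u} s≢𝟘 t≢𝟘 u≢𝟘 s≢t with u ≟ˢ s
... | yes u≡s = inj₁ u≡s
... | no  u≢s = inj₂ (trans (apart⇒neg s≢𝟘 u≢𝟘 (u≢s ∘ sym)) (sym (apart⇒neg s≢𝟘 t≢𝟘 s≢t)))

·-neg : ∀ {s} → s ≢ 𝟘 → s · neg s ≡ -
·-neg {+} _ = refl
·-neg { - } _ = refl
·-neg {𝟘} nz = contradiction refl nz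

neg-·-self : ∀ {s} → s ≢ 𝟘 → neg s · s ≡ -
neg-·-self {+} _ = refl
neg-·-self { - } _ = refl
neg-·-self {𝟘} nz = contradiction refl nz

·-self : ∀ s → s · s ≢ -
·-self + ()
·-self - ()
·-self 𝟘 ()

·-zeroʳ : ∀ s → s · 𝟘 ≡ 𝟘
·-zeroʳ + = refl
·-zeroʳ - = refl
·-zeroʳ 𝟘 = refl

·-negˡ : ∀ s t → neg s · t ≡ neg (s · t)
·-negˡ + _ = refl
·-negˡ - + = refl
·-negˡ - - = refl
·-negˡ - 𝟘 = refl
·-negˡ 𝟘 _ = refl

·-negʳ : ∀ s t → s · neg t ≡ neg (s · t)
·-negʳ + _ = refl
·-negʳ - _ = refl
·-negʳ 𝟘 _ = refl

·-neg-neg : ∀ s t → neg s · neg t ≡ s · t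
·-neg-neg + + = refl
·-neg-neg + - = refl
·-neg-neg + 𝟘 = refl
·-neg-neg - _ = refl
·-neg-neg 𝟘 _ = refl

·-nonzero : ∀ {s t} → s ≢ 𝟘 → t ≢ 𝟘 → s · t ≢ 𝟘
·-nonzero {+} _ t≢𝟘 = t≢𝟘
·-nonzero { - } _ t≢𝟘 = t≢𝟘 ∘ neg≡𝟘
·-nonzero {𝟘} s≢𝟘 _ = λ _ → s≢𝟘 refl

·-nonzeroˡ : ∀ {s t} → s · t ≢ 𝟘 → s ≢ 𝟘
·-nonzeroˡ st≢𝟘 refl = st≢𝟘 refl

·-nonzeroʳ : ∀ s {t} → s · t ≢ 𝟘 → t ≢ 𝟘
·-nonzeroʳ s st≢𝟘 refl = st≢𝟘 (·-zeroʳ s)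

-- Sign vectors

module _ {n : ℕ} where

  private
    variable
      X Y Z : SignVec n

  lookup-ext : (∀ e → lookup X e ≡ lookup Y e) → X ≡ Y
  lookup-ext {X} {Y} eq =
    trans (sym (tabulate∘lookup X)) (trans (tabulate-cong eq) (tabulate∘lookup Y))

  lookup-⊚ : ∀ X Y (e : Fin n) → lookup (X ⊚ Y) e ≡ lookup X e ▹ lookup Y e
  lookup-⊚ X Y e = lookup-zipWith _▹_ e X Y

  lookup-⊚⊝ : ∀ X Y (e : Fin n) → lookup (X ⊚ ⊝ Y) e ≡ lookup X e ▹ neg (lookup Y e)
  lookup-⊚⊝ X Y e = trans (lookup-⊚ X (⊝ Y) e) (cong (lookup X e ▹_) (lookup-map e neg Y))

  lookup-⊚-zeroˡ : ∀ X Y {e : Fin n} → lookup X e ≡ 𝟘 → lookup (X ⊚ Y) e ≡ lookup Y e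
  lookup-⊚-zeroˡ X Y {e} Xe≡𝟘 = trans (lookup-⊚ X Y e) (cong (_▹ lookup Y e) Xe≡𝟘)

  lookup-⊚⊝-zeroˡ : ∀ X Y {e : Fin n} → lookup X e ≡ 𝟘 → lookup (X ⊚ ⊝ Y) e ≡ neg (lookup Y e)
  lookup-⊚⊝-zeroˡ X Y {e} Xe≡𝟘 = trans (lookup-⊚⊝ X Y e) (cong (_▹ neg (lookup Y e)) Xe≡𝟘)

  lookup-⊚-nonzeroˡ : ∀ X Y {e : Fin n} → lookup X e ≢ 𝟘 → lookup (X ⊚ Y) e ≡ lookup X e
  lookup-⊚-nonzeroˡ X Y {e} Xe≢𝟘 = trans (lookup-⊚ X Y e) (▹-nonzeroˡ _ Xe≢𝟘)

  ⊚⊝⊚⊝ : ∀ X Y → X ⊚ ⊝ (X ⊚ ⊝ Y) ≡ X ⊚ Y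
  ⊚⊝⊚⊝ X Y = lookup-ext λ e → begin
    lookup (X ⊚ ⊝ (X ⊚ ⊝ Y)) e                          ≡⟨ lookup-⊚⊝ X (X ⊚ ⊝ Y) e ⟩
    lookup X e ▹ neg (lookup (X ⊚ ⊝ Y) e)               ≡⟨ cong (λ s → lookup X e ▹ neg s) (lookup-⊚⊝ X Y e) ⟩
    lookup X e ▹ neg (lookup X e ▹ neg (lookup Y e))    ≡⟨ ▹-neg-neg (lookup X e) (lookup Y e) ⟩
    lookup X e ▹ lookup Y e                             ≡⟨ lookup-⊚ X Y e ⟨
    lookup (X ⊚ Y) e                                    ∎
    where open ≡-Reasoning

  ⊚-noZero : ∀ X Y → NoZero Y → NoZero (X ⊚ Y)
  ⊚-noZero X Y Y-nz e = subst (_≢ 𝟘) (sym (lookup-⊚ X Y e)) (▹-nonzero (lookup X e) (Y-nz e))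

  ⊝-noZero : ∀ (X : SignVec n) → NoZero X → NoZero (⊝ X)
  ⊝-noZero X X-nz e = X-nz e ∘ neg≡𝟘 ∘ trans (sym (lookup-map e neg X))

  infix 4 _⊑_ _⊑?_
  -- The usual order of sign vectors, generated by `𝟘` below `+` and `𝟘` below `-`; for a tope `T`,
  -- `X ⊑ T` expresses that `T` is above `X`.
  _⊑_ : SignVec n → SignVec n → Set
  X ⊑ Y = ∀ e → lookup X e ≡ 𝟘 ⊎ lookup X e ≡ lookup Y e

  _⊑?_ : ∀ X → Decidable (X ⊑_)
  X ⊑? Y = all? λ e → (lookup X e ≟ˢ 𝟘) ⊎-dec (lookup X e ≟ˢ lookup Y e)

  ⊑-nonzero : ∀ X Y → X ⊑ Y → ∀ {e} → lookup X e ≢ 𝟘 → lookup X e ≡ lookup Y e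
  ⊑-nonzero _ _ X⊑Y {e} Xe≢𝟘 = [ (λ z → contradiction z Xe≢𝟘) , (λ p → p) ]′ (X⊑Y e)

  ⊑-⊚ˡ : ∀ X Y → X ⊑ X ⊚ Y
  ⊑-⊚ˡ X Y e with lookup X e ≟ˢ 𝟘
  ... | yes Xe≡𝟘 = inj₁ Xe≡𝟘
  ... | no  Xe≢𝟘 = inj₂ (sym (lookup-⊚-nonzeroˡ X Y Xe≢𝟘))

  ⊑-trans : ∀ X Y Z → X ⊑ Y → Y ⊑ Z → X ⊑ Z
  ⊑-trans _ _ _ X⊑Y Y⊑Z e with X⊑Y e
  ... | inj₁ Xe≡𝟘 = inj₁ Xe≡𝟘
  ... | inj₂ Xe≡Ye with Y⊑Z e
  ...   | inj₁ Ye≡𝟘 = inj₁ (trans Xe≡Ye Ye≡𝟘)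
  ...   | inj₂ Ye≡Ze = inj₂ (trans Xe≡Ye Ye≡Ze)

  apart⇒Sep : ∀ (X Y : SignVec n) → NoZero X → NoZero Y → ∀ {e} → lookup X e ≢ lookup Y e → e ∈ Sep X Y
  apart⇒Sep X Y X-nz Y-nz {e} Xe≢Ye =
    trans (cong (lookup X e ·_) (apart⇒neg (X-nz e) (Y-nz e) Xe≢Ye)) (·-neg (X-nz e))

  equal⇒∉Sep : ∀ (X Y : SignVec n) {e} → lookup X e ≡ lookup Y e → e ∉ Sep X Y
  equal⇒∉Sep X Y {e} Xe≡Ye XeYe≡- =
    ·-self (lookup X e) (trans (cong (lookup X e ·_) Xe≡Ye) XeYe≡-)

  zeroʳ⇒∉Sep : ∀ (X Y : SignVec n) {e} → lookup Y e ≡ 𝟘 → e ∉ Sep X Y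
  zeroʳ⇒∉Sep X Y {e} Ye≡𝟘 XeYe≡-
    with () ← trans (sym (trans (cong (lookup X e ·_) Ye≡𝟘) (·-zeroʳ (lookup X e)))) XeYe≡-

  -- The interval of the hypercube: `hamming-between` and `between-hamming` identify it with
  -- equality in the triangle inequality for the Hamming distance.
  Between : SignVec n → SignVec n → SignVec n → Set
  Between X Z Y = ∀ e → lookup Z e ≡ lookup X e ⊎ lookup Z e ≡ lookup Y e

  ⊑-between : ∀ X {Y Z} W → X ⊑ Y → X ⊑ Z → Between Y W Z → X ⊑ W
  ⊑-between _ _ X⊑Y X⊑Z Y-W-Z e with X⊑Y e | X⊑Z e | Y-W-Z e
  ... | inj₁ Xe≡𝟘  | _          | _          = inj₁ Xe≡𝟘
  ... | inj₂ _     | inj₁ Xe≡𝟘  | _          = inj₁ Xe≡𝟘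
  ... | inj₂ Xe≡Ye | inj₂ _     | inj₁ We≡Ye = inj₂ (trans Xe≡Ye (sym We≡Ye))
  ... | inj₂ _     | inj₂ Xe≡Ze | inj₂ We≡Ze = inj₂ (trans Xe≡Ze (sym We≡Ze))

-- Hamming distance

δ : Sign → Sign → ℕ
δ s t = if does (s ≟ˢ t) then 0 else 1

δ-refl : ∀ s → δ s s ≡ 0
δ-refl + = refl
δ-refl - = refl
δ-refl 𝟘 = refl

δ≡0⇒≡ : ∀ s t → δ s t ≡ 0 → s ≡ t
δ≡0⇒≡ s t δ≡0 with s ≟ˢ t
... | yes s≡t = s≡t

δ-apart : ∀ {s t} → s ≢ t → δ s t ≡ 1
δ-apart {s} {t} s≢t with s ≟ˢ t
... | yes s≡t = contradiction s≡t s≢t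
... | no _ = refl

δ≤1 : ∀ s t → δ s t ≤ 1
δ≤1 s t with s ≟ˢ t
... | yes _ = z≤n
... | no _ = ℕₚ.≤-refl

δ-triangle : ∀ s t u → δ s u ≤ δ s t +ᴺ δ t u
δ-triangle s t u with s ≟ˢ t
... | yes refl = ℕₚ.≤-refl
... | no _ = ℕₚ.≤-trans (δ≤1 s u) (ℕₚ.m≤m+n 1 (δ t u))

δ-between : ∀ s t u → t ≡ s ⊎ t ≡ u → δ s t +ᴺ δ t u ≡ δ s u
δ-between s t u (inj₁ refl) = cong (_+ᴺ δ s u) (δ-refl s)
δ-between s t u (inj₂ refl) = trans (cong (δ s u +ᴺ_) (δ-refl u)) (ℕₚ.+-identityʳ _)

between-δ : ∀ s t u → δ s t +ᴺ δ t u ≤ δ s u → t ≡ s ⊎ t ≡ u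
between-δ s t u le with s ≟ˢ t | t ≟ˢ u
... | yes s≡t | _ = inj₁ (sym s≡t)
... | no _ | yes t≡u = inj₂ t≡u
... | no _ | no _ = contradiction (ℕₚ.≤-trans le (δ≤1 s u)) (ℕₚ.<⇒≱ ℕₚ.≤-refl)

hamming : ∀ {n} → SignVec n → SignVec n → ℕ
hamming []      []      = 0
hamming (s ∷ x) (t ∷ y) = δ s t +ᴺ hamming x y

hamming-refl : ∀ {n} (x : SignVec n) → hamming x x ≡ 0
hamming-refl []      = refl
hamming-refl (s ∷ x) = cong₂ _+ᴺ_ (δ-refl s) (hamming-refl x)

hamming≡0⇒≡ : ∀ {n} (x y : SignVec n) → hamming x y ≡ 0 → x ≡ y
hamming≡0⇒≡ []      []      _  = refl
hamming≡0⇒≡ (s ∷ x) (t ∷ y) eq =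
  cong₂ _∷_ (δ≡0⇒≡ s t (ℕₚ.m+n≡0⇒m≡0 _ eq)) (hamming≡0⇒≡ x y (ℕₚ.m+n≡0⇒n≡0 (δ s t) eq))

hamming-triangle : ∀ {n} (x y z : SignVec n) → hamming x z ≤ hamming x y +ᴺ hamming y z
hamming-triangle [] [] [] = z≤n
hamming-triangle (s ∷ x) (t ∷ y) (u ∷ z) = begin
  δ s u +ᴺ hamming x z                                  ≤⟨ ℕₚ.+-mono-≤ (δ-triangle s t u) (hamming-triangle x y z) ⟩
  (δ s t +ᴺ δ t u) +ᴺ (hamming x y +ᴺ hamming y z)      ≡⟨ interchange (δ s t) (δ t u) (hamming x y) (hamming y z) ⟩
  (δ s t +ᴺ hamming x y) +ᴺ (δ t u +ᴺ hamming y z)      ∎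
  where open ≤-Reasoning

hamming-between : ∀ {n} (x y z : SignVec n) → Between x y z →
                  hamming x y +ᴺ hamming y z ≡ hamming x z
hamming-between [] [] [] _ = refl
hamming-between (s ∷ x) (t ∷ y) (u ∷ z) b = begin
  (δ s t +ᴺ hamming x y) +ᴺ (δ t u +ᴺ hamming y z)      ≡⟨ interchange (δ s t) (hamming x y) (δ t u) (hamming y z) ⟩
  (δ s t +ᴺ δ t u) +ᴺ (hamming x y +ᴺ hamming y z)      ≡⟨ cong₂ _+ᴺ_ (δ-between s t u (b zero)) (hamming-between x y z (b ∘ suc)) ⟩
  δ s u +ᴺ hamming x z                                  ∎
  where open ≡-Reasoning

-- The triangle inequality holds separately for the first coordinate and for the rest, so the
-- reverse inequality for the sum forces it for each of them.
between-hamming : ∀ {n} (x y z : SignVec n) →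
                  hamming x y +ᴺ hamming y z ≤ hamming x z → Between x y z
between-hamming (s ∷ x) (t ∷ y) (u ∷ z) le = λ where
    zero    → between-δ s t u (ℕₚ.+-cancelʳ-≤ _ _ _
                (ℕₚ.≤-trans le′ (ℕₚ.+-monoʳ-≤ (δ s u) (hamming-triangle x y z))))
    (suc e) → between-hamming x y z (ℕₚ.+-cancelˡ-≤ _ _ _
                (ℕₚ.≤-trans le′ (ℕₚ.+-monoˡ-≤ (hamming x z) (δ-triangle s t u)))) e
  where
  le′ : (δ s t +ᴺ δ t u) +ᴺ (hamming x y +ᴺ hamming y z) ≤ δ s u +ᴺ hamming x z
  le′ = subst (_≤ δ s u +ᴺ hamming x z)
          (interchange (δ s t) (hamming x y) (δ t u) (hamming y z)) le

hamming-edge : ∀ {n} (e : Fin n) x y → DifferExactlyAt e x y → hamming x y ≡ 1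
hamming-edge zero (s ∷ x) (t ∷ y) (s≢t , same) = cong₂ _+ᴺ_ (δ-apart s≢t)
  (trans (cong (hamming x) (lookup-ext λ f → sym (same (suc f) λ ()))) (hamming-refl x))
hamming-edge (suc e) (s ∷ x) (t ∷ y) (d , same) = cong₂ _+ᴺ_
  (trans (cong (δ s) (sym (same zero λ ()))) (δ-refl s))
  (hamming-edge e x y (d , λ f f≢e → same (suc f) λ { refl → f≢e refl }))

hamming-positive : ∀ {n} {x y : SignVec n} → x ≢ y → 0 < hamming x y
hamming-positive x≢y = ℕₚ.n≢0⇒n>0 (x≢y ∘ hamming≡0⇒≡ _ _)

-- Walks

module _ {A : Set} {G : Graph A} where

  infixr 5 _++_
  _++_ : ∀ {x y z} → Walk G x y → Walk G y z → Walk G x z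
  [ _ ]   ++ q = q
  (a ∷ p) ++ q = a ∷ (p ++ q)

  length-++ : ∀ {x y z} (p : Walk G x y) (q : Walk G y z) →
              length (p ++ q) ≡ length p +ᴺ length q
  length-++ [ _ ]   q = refl
  length-++ (_ ∷ p) q = cong suc (length-++ p q)

  passesThrough-source : ∀ {x y} (p : Walk G x y) → PassesThrough x p
  passesThrough-source [ _ ]   = refl
  passesThrough-source (_ ∷ _) = inj₁ refl

  passesThrough-++ : ∀ {x y z} (p : Walk G x y) (q : Walk G y z) → PassesThrough y (p ++ q)
  passesThrough-++ [ _ ]   q = passesThrough-source q
  passesThrough-++ (_ ∷ p) q = inj₂ (passesThrough-++ p q)

  containsWalk-vertex : ∀ (H : Graph A) {x y z} (p : Walk G x y) →
                        ContainsWalk H p → PassesThrough z p → z ∈ V H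
  containsWalk-vertex H [ _ ]   x∈H       refl        = x∈H
  containsWalk-vertex H (_ ∷ p) (a , _)   (inj₁ refl) = Graph.~-vertex H a
  containsWalk-vertex H (_ ∷ p) (_ , p⊆H) (inj₂ thru) = containsWalk-vertex H p p⊆H thru

-- The tope graph of a COM

module _ {n : ℕ} (M : COM n) where

  open COM M using (FS; SE)

  private
    G : Graph (SignVec n)
    G = topeGraph M

    variable
      x y z X Y : SignVec n

  -- By `⊚⊝⊚⊝`, composition is (FS) applied twice.
  ⊚-closed : X ∈ 𝓛 M → Y ∈ 𝓛 M → X ⊚ Y ∈ 𝓛 M
  ⊚-closed {X} {Y} X∈𝓛 Y∈𝓛 = subst (𝓛 M) (⊚⊝⊚⊝ X Y) (FS X∈𝓛 (FS X∈𝓛 Y∈𝓛))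

  ⊚-tope : X ∈ 𝓛 M → Y ∈ 𝓣 M → X ⊚ Y ∈ 𝓣 M
  ⊚-tope {X} {Y} X∈𝓛 (Y∈𝓛 , Y-nz) = ⊚-closed X∈𝓛 Y∈𝓛 , ⊚-noZero X Y Y-nz

  ⊚⊝-tope : X ∈ 𝓛 M → Y ∈ 𝓣 M → X ⊚ ⊝ Y ∈ 𝓣 M
  ⊚⊝-tope {X} {Y} X∈𝓛 (Y∈𝓛 , Y-nz) = FS X∈𝓛 Y∈𝓛 , ⊚-noZero X (⊝ Y) (⊝-noZero Y Y-nz)

  vertex : x ∈ 𝓣 M → x ∈ V G
  vertex x∈𝓣 = proj₂ x∈𝓣 , x∈𝓣

  hamming≤length : (p : Walk G x y) → hamming x y ≤ length p
  hamming≤length {x} [ _ ] = ℕₚ.≤-reflexive (hamming-refl x)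
  hamming≤length {x} {y} (_∷_ {y = x′} ((_ , _ , e , d) , _) p) = begin
    hamming x y                      ≤⟨ hamming-triangle x x′ y ⟩
    hamming x x′ +ᴺ hamming x′ y     ≤⟨ ℕₚ.+-mono-≤ (ℕₚ.≤-reflexive (hamming-edge e x x′ d)) (hamming≤length p) ⟩
    suc (length p)                   ∎
    where open ≤-Reasoning

  hamming-shortest : (p : Walk G x y) → length p ≡ hamming x y → Shortest p
  hamming-shortest p eq q = ℕₚ.≤-trans (ℕₚ.≤-reflexive eq) (hamming≤length q)

  -- Faces as subgraphs of the tope graph

  face : SignVec n → Graph (SignVec n)
  face X = induced G (X ⊑_) (X ⊑?_)

  face⊆G : ∀ X → face X ≤ᴳ G
  face⊆G X = record { vertices = proj₁ ; edges = proj₁ }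

  -- The length bound, unlike `Shortest`, passes directly to the tail, since the first edge changes
  -- the Hamming distance by at most one. It also puts the next vertex between `x` and `y`, hence
  -- above `X`.
  face-containsWalk : ∀ X → X ⊑ x → X ⊑ y → (p : Walk G x y) → length p ≤ hamming x y →
                      ContainsWalk (face X) p
  face-containsWalk _ X⊑x _ [ x∈G ] _ = x∈G , X⊑x
  face-containsWalk {x} {y} X X⊑x X⊑y (_∷_ {y = x′} a@((_ , _ , e , d) , _) p) le =
    (a , X⊑x , X⊑x′) , face-containsWalk X X⊑x′ X⊑y p (ℕₚ.≤-pred (ℕₚ.≤-trans le
      (ℕₚ.≤-trans (hamming-triangle x x′ y) (ℕₚ.≤-reflexive (cong (_+ᴺ hamming x′ y) xx′≡1)))))
    where
    xx′≡1 : hamming x x′ ≡ 1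
    xx′≡1 = hamming-edge e x x′ d

    X⊑x′ : X ⊑ x′
    X⊑x′ = ⊑-between X {x} {y} x′ X⊑x X⊑y (between-hamming x x′ y (ℕₚ.≤-trans
      (ℕₚ.+-mono-≤ (ℕₚ.≤-reflexive xx′≡1) (hamming≤length p)) le))

  -- The criterion for being a covector

  eliminateAbove : ∀ X {Z W e} → Z ∈ 𝓛 M → X ⊑ Z → W ∈ 𝓛 M → X ⊑ W → e ∈ Sep Z W →
    ∃[ U ] U ∈ 𝓛 M × X ⊑ U × lookup U e ≡ 𝟘 × (∀ f → lookup W f ≡ 𝟘 → lookup U f ≡ lookup Z f)
  -- (SE) controls `U` off `Sep Z W`. On the support of `X` both `Z` and `W` agree with `X`, and a
  -- zero of `W` is not separated either; so `U` stays above `X` and copies `Z` wherever `W` is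
  -- zero.
  eliminateAbove X {Z} {W} {e} Z∈𝓛 X⊑Z W∈𝓛 X⊑W e∈Sep with SE Z∈𝓛 W∈𝓛 e∈Sep
  ... | U , U∈𝓛 , Ue≡𝟘 , same = U , U∈𝓛 , X⊑U , Ue≡𝟘 , λ f Wf≡𝟘 →
      trans (same f (zeroʳ⇒∉Sep Z W Wf≡𝟘))
        (trans (lookup-⊚ Z W f) (trans (cong (lookup Z f ▹_) Wf≡𝟘) (▹-identityʳ _)))
    where
    X⊑U : X ⊑ U
    X⊑U f with X⊑Z f | X⊑W f
    ... | inj₁ Xf≡𝟘  | _          = inj₁ Xf≡𝟘
    ... | inj₂ _     | inj₁ Xf≡𝟘  = inj₁ Xf≡𝟘
    ... | inj₂ Xf≡Zf | inj₂ Xf≡Wf = inj₂ (sym (begin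
        lookup U f                 ≡⟨ same f (equal⇒∉Sep Z W (trans (sym Xf≡Zf) Xf≡Wf)) ⟩
        lookup (Z ⊚ W) f           ≡⟨ lookup-⊚ Z W f ⟩
        lookup Z f ▹ lookup W f    ≡⟨ cong₂ _▹_ (sym Xf≡Zf) (sym Xf≡Wf) ⟩
        lookup X f ▹ lookup X f    ≡⟨ ▹-idem _ ⟩
        lookup X f                 ∎))
      where open ≡-Reasoning

  module _ {X T₀ : SignVec n} (T₀∈𝓣 : T₀ ∈ 𝓣 M) (X⊑T₀ : X ⊑ T₀)
           (symmetric : ∀ {T} → T ∈ 𝓣 M → X ⊑ T → X ⊚ ⊝ T ∈ 𝓣 M) where

    private
      VanishingOn : List (Fin n) → Set
      VanishingOn A = ∃[ Z ] Z ∈ 𝓛 M × X ⊑ Z × (∀ {e} → e ∈ˡ A → lookup Z e ≡ 𝟘)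

      -- These are the `Uᵉ` of the induction; the sign at `e` is an index so that it can be required
      -- to match a tope.
      VanishingOff : List (Fin n) → Fin n → Sign → Set
      VanishingOff A e s = ∃[ U ] U ∈ 𝓛 M × X ⊑ U × lookup U e ≡ s ×
                           (∀ {f} → f ∈ˡ A → f ≢ e → lookup U f ≡ 𝟘)

      module _ (A : List (Fin n)) (X-zero : ∀ {e} → e ∈ˡ A → lookup X e ≡ 𝟘)
               (off : ∀ {e} → e ∈ˡ A → ∃[ s ] VanishingOff A e s) where

        -- The `Uᵉ` are composed one after another onto the left of `T₀`. Since `Uᵉ` vanishes on the
        -- rest of `A`, it overwrites only the coordinate `e` there. The first alternative covers a
        -- `Uᵉ` that is zero at `e` too: it already vanishes on all of `A`.
        alignedTope : ∀ es → (∀ {e} → e ∈ˡ es → e ∈ˡ A) → VanishingOn A ⊎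
          (∃[ T ] T ∈ 𝓣 M × X ⊑ T × (∀ {e} → e ∈ˡ es → VanishingOff A e (lookup T e)))
        alignedTope [] _ = inj₂ (T₀ , T₀∈𝓣 , X⊑T₀ , λ ())
        alignedTope (e ∷ es) es⊆A with alignedTope es (es⊆A ∘ there)
        ... | inj₁ done = inj₁ done
        ... | inj₂ (T , T∈𝓣 , X⊑T , us) with off (es⊆A (here refl))
        ...   | s , U , U∈𝓛 , X⊑U , Ue≡s , U-zero with lookup U e ≟ˢ 𝟘
        ...     | yes Ue≡𝟘 = inj₁ (U , U∈𝓛 , X⊑U , vanish)
          where
          vanish : ∀ {f} → f ∈ˡ A → lookup U f ≡ 𝟘
          vanish {f} f∈A with f ≟ᶠ e
          ... | yes refl = Ue≡𝟘
          ... | no f≢e = U-zero f∈A f≢e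
        ...     | no Ue≢𝟘 = inj₂ (U ⊚ T , ⊚-tope U∈𝓛 T∈𝓣 , ⊑-trans X U (U ⊚ T) X⊑U (⊑-⊚ˡ U T) , aligned)
          where
          aligned : ∀ {f} → f ∈ˡ e ∷ es → VanishingOff A f (lookup (U ⊚ T) f)
          -- `es` may repeat `e`, so equality with `e` is decided before membership: the entry at
          -- `e` comes from the new `U`.
          aligned {f} f∈ with f ≟ᶠ e | f∈
          ... | yes refl | _        = U , U∈𝓛 , X⊑U , sym (lookup-⊚-nonzeroˡ U T Ue≢𝟘) , U-zero
          ... | no f≢e   | here f≡e = contradiction f≡e f≢e
          ... | no f≢e   | there f∈es = subst (VanishingOff A f)
            (sym (lookup-⊚-zeroˡ U T (U-zero (es⊆A f∈) f≢e))) (us f∈es)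

        module _ {T} (T∈𝓣 : T ∈ 𝓣 M) (X⊑T : X ⊑ T)
                 (us : ∀ {e} → e ∈ˡ A → VanishingOff A e (lookup T e)) where

          -- The last clause is the invariant. If `Z` is nonzero at `e`, it is opposite to `Uᵉ`,
          -- which agrees with `T` there, so (SE) applies. The other coordinates of `A` are zeros of
          -- `Uᵉ` and keep their values, in particular the zeros already made.
          eliminateAll : ∀ es → (∀ {e} → e ∈ˡ es → e ∈ˡ A) →
            ∃[ Z ] Z ∈ 𝓛 M × X ⊑ Z × (∀ {e} → e ∈ˡ es → lookup Z e ≡ 𝟘) ×
              (∀ {e} → e ∈ˡ A → lookup Z e ≡ 𝟘 ⊎ lookup Z e ≡ neg (lookup T e))
          -- The assumed symmetry supplies the start, which is opposite to `T` on all of `A` because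
          -- `X` vanishes there.
          eliminateAll [] _ = X ⊚ ⊝ T , proj₁ (symmetric T∈𝓣 X⊑T) , ⊑-⊚ˡ X (⊝ T) , (λ ()) ,
            λ e∈A → inj₂ (lookup-⊚⊝-zeroˡ X T (X-zero e∈A))
          eliminateAll (e ∷ es) es⊆A with eliminateAll es (es⊆A ∘ there)
          ... | Z , Z∈𝓛 , X⊑Z , Z-zero , Z-neg with Z-neg (es⊆A (here refl))
          ...   | inj₁ Ze≡𝟘 = Z , Z∈𝓛 , X⊑Z , (λ { (here refl) → Ze≡𝟘 ; (there f∈) → Z-zero f∈ }) , Z-neg
          ...   | inj₂ Ze≡-Te with us (es⊆A (here refl))
          ...     | U , U∈𝓛 , X⊑U , Ue≡Te , U-zero
            with eliminateAbove X Z∈𝓛 X⊑Z U∈𝓛 X⊑U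
                   (trans (cong₂ _·_ Ze≡-Te Ue≡Te) (neg-·-self (proj₂ T∈𝓣 e)))
          ...       | W , W∈𝓛 , X⊑W , We≡𝟘 , same = W , W∈𝓛 , X⊑W , W-zero , W-neg
            where
            W-zero : ∀ {f} → f ∈ˡ e ∷ es → lookup W f ≡ 𝟘
            W-zero {f} f∈ with f ≟ᶠ e | f∈
            ... | yes refl | _ = We≡𝟘
            ... | no f≢e | here f≡e = contradiction f≡e f≢e
            ... | no f≢e | there f∈es = trans (same f (U-zero (es⊆A f∈) f≢e)) (Z-zero f∈es)

            W-neg : ∀ {f} → f ∈ˡ A → lookup W f ≡ 𝟘 ⊎ lookup W f ≡ neg (lookup T f)
            W-neg {f} f∈A with f ≟ᶠ e
            ... | yes refl = inj₁ We≡𝟘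
            ... | no f≢e = subst (λ s → s ≡ 𝟘 ⊎ s ≡ neg (lookup T f))
                             (sym (same f (U-zero f∈A f≢e))) (Z-neg f∈A)

        vanishingStep : VanishingOn A
        vanishingStep with alignedTope A (λ e∈A → e∈A)
        ... | inj₁ done = done
        ... | inj₂ (T , T∈𝓣 , X⊑T , us) with eliminateAll T∈𝓣 X⊑T us A (λ e∈A → e∈A)
        ...   | Z , Z∈𝓛 , X⊑Z , Z-zero , _ = Z , Z∈𝓛 , X⊑Z , Z-zero

      -- Strong induction on the length. All copies of `e` are filtered out, and the result is
      -- shorter since `e` occurs in `A`. The empty list is no separate case: `vanishingStep` then
      -- returns `X ∘ (-T₀)`.
      vanishing : ∀ A → Acc _<_ (List.length A) → (∀ {e} → e ∈ˡ A → lookup X e ≡ 𝟘) → VanishingOn A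
      vanishing A (acc rec) X-zero = vanishingStep A X-zero off
        where
        off : ∀ {e} → e ∈ˡ A → ∃[ s ] VanishingOff A e s
        off {e} e∈A with vanishing (List.filter (λ f → ¬? (f ≟ᶠ e)) A)
          (rec (filter-notAll (λ f → ¬? (f ≟ᶠ e)) A (Any.map (λ e≡f f≢e → f≢e (sym e≡f)) e∈A)))
          (λ f∈ → X-zero (proj₁ (∈-filter⁻ (λ f → ¬? (f ≟ᶠ e)) f∈)))
        ... | U , U∈𝓛 , X⊑U , U-zero = lookup U e , U , U∈𝓛 , X⊑U , refl ,
          λ f∈A f≢e → U-zero (∈-filter⁺ (λ f → ¬? (f ≟ᶠ e)) f∈A f≢e)

    private
      zero? : Decidable (λ e → lookup X e ≡ 𝟘)
      zero? e = lookup X e ≟ˢ 𝟘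

    -- A covector above `X` that vanishes at every zero of `X` must be `X` itself.
    covector : X ∈ 𝓛 M
    covector with vanishing (List.filter zero? (List.allFin n)) (<-wellFounded _)
                    (λ e∈ → proj₂ (∈-filter⁻ zero? {xs = List.allFin n} e∈))
    ... | Z , Z∈𝓛 , X⊑Z , Z-zero = subst (𝓛 M) (sym (lookup-ext X≗Z)) Z∈𝓛
      where
      X≗Z : ∀ e → lookup X e ≡ lookup Z e
      X≗Z e with X⊑Z e
      ... | inj₁ Xe≡𝟘  = trans Xe≡𝟘 (sym (Z-zero (∈-filter⁺ zero? (∈-allFin e) Xe≡𝟘)))
      ... | inj₂ Xe≡Ze = Xe≡Ze

  𝓛ᴳ⇒covector : ∀ {T} → T ∈ 𝓣 M → X ∈ 𝓛ᴳ G → X ∈ 𝓛 M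
  -- The tope above `X` is `X ∘ -(X ∘ -T)`, which is `X ∘ T`, obtained by using the hypothesis
  -- twice.
  𝓛ᴳ⇒covector {X} {T} T∈𝓣 X∈𝓛ᴳ = covector (proj₂ (X∈𝓛ᴳ _ (vertex (proj₂ (X∈𝓛ᴳ T (vertex T∈𝓣))))))
    (⊑-⊚ˡ X _) (λ {W} W∈𝓣 _ → proj₂ (X∈𝓛ᴳ W (vertex W∈𝓣)))

  -- Existence of topes and isometry of the tope graph

  module _ (simple : Simple M) where

    open Simple simple

    -- Composition preserves the nonzero entries of its left factor, so composing with covectors
    -- that are `+` at the successive coordinates fills all of them.
    tope : ∃[ T ] T ∈ 𝓣 M
    tope with covering (List.allFin n)
      where
      covering : ∀ es → ∃[ X ] X ∈ 𝓛 M × (∀ {e} → e ∈ˡ es → lookup X e ≢ 𝟘)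
      covering [] = proj₁ (COM.nonempty M) , proj₂ (COM.nonempty M) , λ ()
      covering (e ∷ es) with allValues e + | covering es
      ... | Y , Y∈𝓛 , Ye≡+ | X , X∈𝓛 , X-nz = X ⊚ Y , ⊚-closed X∈𝓛 Y∈𝓛 , λ where
          (here refl) → subst (_≢ 𝟘) (sym (lookup-⊚ X Y e))
                          (▹-nonzero (lookup X e) (λ Ye≡𝟘 → +≢𝟘 (trans (sym Ye≡+) Ye≡𝟘)))
          (there f∈)  → X-nz f∈ ∘ trans (sym (lookup-⊚-nonzeroˡ X Y (X-nz f∈)))
        where
        +≢𝟘 : + ≢ 𝟘
        +≢𝟘 ()
    ... | T , T∈𝓛 , T-nz = T , T∈𝓛 , λ e → T-nz (∈-allFin e)

    separating : ∀ {e f} → e ≢ f → ∀ {s} → s ≢ 𝟘 → ∃[ W ] W ∈ 𝓛 M × lookup W e · lookup W f ≡ s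
    separating e≢f {s} s≢𝟘 with separated e≢f | s
    ... | X , _ , X∈𝓛 , _ , XeXf≡+ , _ | + = X , X∈𝓛 , XeXf≡+
    ... | _ , Y , _ , Y∈𝓛 , _ , YeYf≡- | - = Y , Y∈𝓛 , YeYf≡-
    ... | _ | 𝟘 = contradiction refl s≢𝟘

    -- Meant for a `Z` vanishing at `e`, so that the tope `Z ∘ V` has the entry of `V` there. If `Z`
    -- agrees with `x` at `f`, take `y`, which is opposite to `x` at `e`; if `Z` is opposite to `x`
    -- at `f`, take `x`. If `Z` is zero at `f`, simplicity provides a covector with the desired
    -- product, completed to a tope by `x`.
    oppositeParity : ∀ {e f} → x ∈ 𝓣 M → y ∈ 𝓣 M → e ≢ f → lookup x e ≢ lookup y e → ∀ Z →
      ∃[ V ] V ∈ 𝓣 M × lookup V e · lookup (Z ⊚ V) f ≡ neg (lookup x e · lookup x f)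
    oppositeParity {x} {y} {e} {f} x∈𝓣@(_ , x-nz) y∈𝓣@(_ , y-nz) e≢f xe≢ye Z = cases
      where
      open ≡-Reasoning

      xe xf ye : Sign
      xe = lookup x e
      xf = lookup x f
      ye = lookup y e

      cases : ∃[ V ] V ∈ 𝓣 M × lookup V e · lookup (Z ⊚ V) f ≡ neg (xe · xf)
      cases with lookup Z f ≟ˢ 𝟘 | lookup Z f ≟ˢ xf
      ... | no Zf≢𝟘 | yes Zf≡xf = y , y∈𝓣 , (begin
          ye · lookup (Z ⊚ y) f  ≡⟨ cong₂ _·_ (apart⇒neg (x-nz e) (y-nz e) xe≢ye)
                                              (trans (lookup-⊚-nonzeroˡ Z y Zf≢𝟘) Zf≡xf) ⟩
          neg xe · xf            ≡⟨ ·-negˡ xe xf ⟩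
          neg (xe · xf)          ∎)
      ... | no Zf≢𝟘 | no Zf≢xf = x , x∈𝓣 , (begin
          xe · lookup (Z ⊚ x) f  ≡⟨ cong (xe ·_) (trans (lookup-⊚-nonzeroˡ Z x Zf≢𝟘)
                                                        (apart⇒neg (x-nz f) Zf≢𝟘 (Zf≢xf ∘ sym))) ⟩
          xe · neg xf            ≡⟨ ·-negʳ xe xf ⟩
          neg (xe · xf)          ∎)
      ... | yes Zf≡𝟘 | _ with separating e≢f (·-nonzero (x-nz e) (x-nz f) ∘ neg≡𝟘)
      ...   | W , W∈𝓛 , WeWf = W ⊚ x , ⊚-tope W∈𝓛 x∈𝓣 , (begin
          lookup (W ⊚ x) e · lookup (Z ⊚ W ⊚ x) f
            ≡⟨ cong (lookup (W ⊚ x) e ·_) (lookup-⊚-zeroˡ Z (W ⊚ x) Zf≡𝟘) ⟩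
          lookup (W ⊚ x) e · lookup (W ⊚ x) f
            ≡⟨ cong₂ _·_ (lookup-⊚-nonzeroˡ W x (·-nonzeroˡ WeWf≢𝟘))
                         (lookup-⊚-nonzeroˡ W x (·-nonzeroʳ (lookup W e) WeWf≢𝟘)) ⟩
          lookup W e · lookup W f
            ≡⟨ WeWf ⟩
          neg (xe · xf) ∎)
        where
        WeWf≢𝟘 : lookup W e · lookup W f ≢ 𝟘
        WeWf≢𝟘 = ·-nonzero (x-nz e) (x-nz f) ∘ neg≡𝟘 ∘ trans (sym WeWf)

    -- x and y agree on the product of the coordinates e and f, so a tope in
    -- between with the opposite product differs from both.
    strictlyBetween : ∀ {e f} → x ∈ 𝓣 M → y ∈ 𝓣 M → e ≢ f →
      lookup x e ≢ lookup y e → lookup x f ≢ lookup y f →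
      ∃[ z ] z ∈ 𝓣 M × Between x z y × x ≢ z × z ≢ y
    strictlyBetween {x} {y} {e} {f} x∈𝓣@(x∈𝓛 , x-nz) y∈𝓣@(y∈𝓛 , y-nz) e≢f xe≢ye xf≢yf
      with SE x∈𝓛 y∈𝓛 (apart⇒Sep x y x-nz y-nz xe≢ye)
    ... | Z , Z∈𝓛 , Ze≡𝟘 , same with oppositeParity x∈𝓣 y∈𝓣 e≢f xe≢ye Z
    ...   | V , V∈𝓣@(_ , V-nz) , parity = Z ⊚ V , ⊚-tope Z∈𝓛 V∈𝓣 , between , x≢z , z≢y
      where
      xe xf : Sign
      xe = lookup x e
      xf = lookup x f

      z-parity : lookup (Z ⊚ V) e · lookup (Z ⊚ V) f ≡ neg (xe · xf)
      z-parity = trans (cong (_· lookup (Z ⊚ V) f) (lookup-⊚-zeroˡ Z V Ze≡𝟘)) parity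

      y-parity : lookup y e · lookup y f ≡ xe · xf
      y-parity = trans (cong₂ _·_ (apart⇒neg (x-nz e) (y-nz e) xe≢ye) (apart⇒neg (x-nz f) (y-nz f) xf≢yf))
                   (·-neg-neg xe xf)

      apart : xe · xf ≢ neg (xe · xf)
      apart = neg-apart (·-nonzero (x-nz e) (x-nz f))

      x≢z : x ≢ Z ⊚ V
      x≢z eq = apart (trans (cong (λ v → lookup v e · lookup v f) eq) z-parity)

      z≢y : Z ⊚ V ≢ y
      z≢y eq = apart (trans (sym y-parity)
                 (trans (cong (λ v → lookup v e · lookup v f) (sym eq)) z-parity))

      between : Between x (Z ⊚ V) y
      between h with lookup x h ≟ˢ lookup y h
      ... | no xh≢yh = two-nonzero (x-nz h) (y-nz h) (⊚-noZero Z V V-nz h) xh≢yh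
      ... | yes xh≡yh = inj₁ (trans (lookup-⊚-nonzeroˡ Z V (x-nz h ∘ trans (sym Zh≡xh))) Zh≡xh)
        where
        Zh≡xh : lookup Z h ≡ lookup x h
        Zh≡xh = trans (same h (equal⇒∉Sep x y xh≡yh)) (lookup-⊚-nonzeroˡ x y (x-nz h))

    -- Strong induction on the Hamming distance. Topes differing in one coordinate are adjacent; if
    -- they differ in two, a tope strictly between them splits the distance into two smaller ones,
    -- whose walks concatenate.
    isometric : Acc _<_ (hamming x y) → x ∈ 𝓣 M → y ∈ 𝓣 M → Σ (Walk G x y) λ p → length p ≡ hamming x y
    isometric {x} {y} (acc rec) x∈𝓣 y∈𝓣 with any? (λ e → ¬? (lookup x e ≟ˢ lookup y e))
    ... | no ¬apart with refl ← lookup-ext {X = x} {Y = y}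
                       (λ e → decidable-stable (_ ≟ˢ _) (λ xe≢ye → ¬apart (e , xe≢ye)))
                  = [ vertex x∈𝓣 ] , sym (hamming-refl x)
    ... | yes (e , xe≢ye) with any? (λ f → ¬? (f ≟ᶠ e) ×-dec ¬? (lookup x f ≟ˢ lookup y f))
    ...   | no ¬apart = ((proj₂ x∈𝓣 , proj₂ y∈𝓣 , e , d) , x∈𝓣 , y∈𝓣) ∷ [ vertex y∈𝓣 ]
                      , sym (hamming-edge e x y d)
      where
      d : DifferExactlyAt e x y
      d = xe≢ye , λ f f≢e → decidable-stable (_ ≟ˢ _) (λ xf≢yf → ¬apart (f , f≢e , xf≢yf))
    ...   | yes (f , f≢e , xf≢yf) with strictlyBetween x∈𝓣 y∈𝓣 (f≢e ∘ sym) xe≢ye xf≢yf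
    ...     | z , z∈𝓣 , x-z-y , x≢z , z≢y = p ++ q , (begin
          length (p ++ q)                   ≡⟨ length-++ p q ⟩
          length p +ᴺ length q              ≡⟨ cong₂ _+ᴺ_ (proj₂ xz) (proj₂ zy) ⟩
          hamming x z +ᴺ hamming z y        ≡⟨ sum ⟩
          hamming x y                       ∎)
      where
      open ≡-Reasoning

      sum : hamming x z +ᴺ hamming z y ≡ hamming x y
      sum = hamming-between x z y x-z-y

      xz : Σ (Walk G x z) λ p → length p ≡ hamming x z
      xz = isometric (rec (subst (hamming x z <_) sum (ℕₚ.m<m+n _ (hamming-positive z≢y)))) x∈𝓣 z∈𝓣

      zy : Σ (Walk G z y) λ q → length q ≡ hamming z y
      zy = isometric (rec (subst (hamming z y <_) sum (ℕₚ.m<n+m _ (hamming-positive x≢z)))) z∈𝓣 y∈𝓣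

      p = proj₁ xz
      q = proj₁ zy

    -- Geodesics and convexity

    geodesicThrough : x ∈ 𝓣 M → z ∈ 𝓣 M → y ∈ 𝓣 M → Between x z y →
                      Σ (Walk G x y) λ p → Shortest p × PassesThrough z p
    geodesicThrough {x} {z} {y} x∈𝓣 z∈𝓣 y∈𝓣 x-z-y
      with isometric {x} {z} (<-wellFounded _) x∈𝓣 z∈𝓣 | isometric {z} {y} (<-wellFounded _) z∈𝓣 y∈𝓣
    ... | p , p-len | q , q-len = p ++ q ,
      hamming-shortest (p ++ q) (trans (length-++ p q)
        (trans (cong₂ _+ᴺ_ p-len q-len) (hamming-between x z y x-z-y))) ,
      passesThrough-++ p q

    -- By isometry `z` lies on a shortest walk from `x` to `y`, and convexity puts that walk into
    -- `H`.
    convex-between : ∀ {H} → Convex G H → x ∈ V H → y ∈ V H → z ∈ 𝓣 M → Between x z y → z ∈ V H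
    convex-between {H = H} H-convex x∈H y∈H z∈𝓣 x-z-y
      with geodesicThrough (tope-of x∈H) z∈𝓣 (tope-of y∈H) x-z-y
      where
      tope-of : ∀ {v} → v ∈ V H → v ∈ 𝓣 M
      tope-of = proj₂ ∘ _≤ᴳ_.vertices (Convex.subgraph H-convex)
    ... | p , p-shortest , thru = containsWalk-vertex H p (Convex.convex H-convex x∈H y∈H p p-shortest) thru

    shortest⇒length : (p : Walk G x y) → Shortest p → length p ≤ hamming x y
    shortest⇒length {x} {y} p p-shortest with isometric {x} {y} (<-wellFounded _) (proj₂ (source p)) (proj₂ (target p))
      where
      source : ∀ {x y} → Walk G x y → x ∈ V G
      source [ x∈G ] = x∈G
      source (a ∷ _) = Graph.~-vertex G a

      target : ∀ {x y} → Walk G x y → y ∈ V G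
      target [ x∈G ] = x∈G
      target (_ ∷ p) = target p
    ... | q , q-len = ℕₚ.≤-trans (p-shortest q) (ℕₚ.≤-reflexive q-len)

    face-convex : ∀ X → Convex G (face X)
    face-convex X = record
      { subgraph = face⊆G X
      ; convex   = λ (_ , X⊑x) (_ , X⊑y) p p-shortest →
          face-containsWalk X X⊑x X⊑y p (shortest⇒length p p-shortest)
      }

    -- Faces of covectors are antipodal and gated

    private
      -- Where `X` is nonzero, `T` and `W` both agree with it; where it is zero, `X ∘ (-T)` is
      -- opposite to `T`, so `W` matches one of the two. Thus the face lies in the interval between
      -- `T` and `X ∘ (-T)`, which makes these antipodes.
      ⊚⊝-opposite : X ∈ 𝓛 M → ∀ {T W} → T ∈ 𝓣 M → W ∈ 𝓣 M → X ⊑ T → X ⊑ W → Between T W (X ⊚ ⊝ T)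
      ⊚⊝-opposite {X} X∈𝓛 {T} {W} T∈𝓣 W∈𝓣 X⊑T X⊑W e with lookup X e ≟ˢ 𝟘
      ... | no Xe≢𝟘 = inj₁ (trans (sym (⊑-nonzero X W X⊑W Xe≢𝟘)) (⊑-nonzero X T X⊑T Xe≢𝟘))
      ... | yes Xe≡𝟘 with lookup W e ≟ˢ lookup T e
      ...   | yes We≡Te = inj₁ We≡Te
      ...   | no We≢Te = inj₂ (trans (apart⇒neg (proj₂ T∈𝓣 e) (proj₂ W∈𝓣 e) (We≢Te ∘ sym))
                (sym (lookup-⊚⊝-zeroˡ X T Xe≡𝟘)))

    face-antipodal : X ∈ 𝓛 M → Antipodal G (face X)
    face-antipodal {X} X∈𝓛 = record
      { subgraph = face⊆G X
      ; nonempty = X ⊚ proj₁ tope , vertex (⊚-tope X∈𝓛 (proj₂ tope)) , ⊑-⊚ˡ X _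
      ; antipode = λ {T} (T∈G , X⊑T) →
          let W∈G = vertex (⊚⊝-tope X∈𝓛 (proj₂ T∈G)) in
          X ⊚ ⊝ T , (W∈G , ⊑-⊚ˡ X _) , record
            { convex   = face-convex X
            ; contains = λ { (inj₁ refl) → T∈G , X⊑T ; (inj₂ refl) → W∈G , ⊑-⊚ˡ X _ }
            ; smallest = λ K K-convex S⊆K →
                let inside : ∀ {z} → z ∈ V (face X) → z ∈ V K
                    inside = λ (z∈G , X⊑z) →
                      convex-between K-convex (S⊆K (inj₁ refl)) (S⊆K (inj₂ refl)) (proj₂ z∈G)
                        (⊚⊝-opposite X∈𝓛 (proj₂ T∈G) (proj₂ z∈G) X⊑T X⊑z)
                in record
                  { vertices = inside
                  -- `K` is not assumed to be induced; its convexity yields the edge because an edge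
                  -- is itself a shortest walk.
                  ; edges    = λ (a , X⊑u , X⊑v) → convex-edge K-convex
                      (inside (Graph.~-vertex G a , X⊑u)) (inside (Graph.~-vertex G (Graph.~-sym G a) , X⊑v)) a
                  }
            }
      }
      where
      convex-edge : ∀ {K u v} → Convex G K → u ∈ V K → v ∈ V K → Graph._~_ G u v → Graph._~_ K u v
      convex-edge {_} {u} {v} K-convex u∈K v∈K a@((_ , _ , e , d) , _) =
        proj₁ (Convex.convex K-convex u∈K v∈K edge (hamming-shortest edge (sym (hamming-edge e u v d))))
        where
        edge : Walk G u v
        edge = a ∷ [ Graph.~-vertex G (Graph.~-sym G a) ]

    -- Passing from `Y` to `X ∘ Y` affects only the support of `X`, where it installs the value
    -- common to all of `H`; so `X ∘ Y` lies between `Y` and every vertex of `H`. Comparing vertices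
    -- with the face suffices, as gates concern walks of `G`.
    gated : ∀ X H → H ≤ᴳ G → X ∈ 𝓛 M → V H ≐ V (face X) → Gated G H
    gated X H H≤G X∈𝓛 (H⊆face , face⊆H) = record
      { subgraph = H≤G
      ; gate     = λ {Y} Y∈G →
          let XY∈𝓣 = ⊚-tope X∈𝓛 (proj₂ Y∈G) in
          X ⊚ Y , face⊆H (vertex XY∈𝓣 , ⊑-⊚ˡ X Y) , λ {W} W∈H →
            geodesicThrough (proj₂ Y∈G) XY∈𝓣 (proj₂ (_≤ᴳ_.vertices H≤G W∈H))
              (λ e → between Y W (proj₂ (H⊆face W∈H)) e)
      }
      where
      between : ∀ Y W → X ⊑ W → Between Y (X ⊚ Y) W
      between Y W X⊑W e with lookup X e ≟ˢ 𝟘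
      ... | yes Xe≡𝟘 = inj₁ (lookup-⊚-zeroˡ X Y Xe≡𝟘)
      ... | no Xe≢𝟘 = inj₂ (trans (lookup-⊚-nonzeroˡ X Y Xe≢𝟘) (⊑-nonzero X W X⊑W Xe≢𝟘))

    -- The sign vector of a face

    module _ (X : SignVec n) (X∈𝓛 : X ∈ 𝓛 M) (H : Graph (SignVec n)) (H≐face : V H ≐ V (face X)) where

      private
        T : SignVec n
        T = X ⊚ proj₁ tope

        T∈𝓣 : T ∈ 𝓣 M
        T∈𝓣 = ⊚-tope X∈𝓛 (proj₂ tope)

        W : SignVec n
        W = X ⊚ ⊝ T

        T∈H : T ∈ V H
        T∈H = proj₂ H≐face (vertex T∈𝓣 , ⊑-⊚ˡ X _)

        W∈H : W ∈ V H
        W∈H = proj₂ H≐face (vertex (⊚⊝-tope X∈𝓛 T∈𝓣) , ⊑-⊚ˡ X _)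

        -- `T` and `W` both lie in `H` and have opposite signs at each zero of `X`.
        not-constant : ∀ {e} → lookup X e ≡ 𝟘 → ∀ {s} → ¬ (∀ v → v ∈ V H → lookup v e ≡ s)
        not-constant {e} Xe≡𝟘 {s} const = neg-apart (proj₂ T∈𝓣 e) (begin
          lookup T e                     ≡⟨ trans (const T T∈H) (sym (const W W∈H)) ⟩
          lookup W e                     ≡⟨ lookup-⊚⊝-zeroˡ X T Xe≡𝟘 ⟩
          neg (lookup T e)               ∎)
          where open ≡-Reasoning

        constant : ∀ {e} → lookup X e ≢ 𝟘 → ∀ v → v ∈ V H → lookup v e ≡ lookup X e
        constant Xe≢𝟘 v v∈H = sym (⊑-nonzero X v (proj₂ (proj₁ H≐face v∈H)) Xe≢𝟘)

        constant⇒ : ∀ {e s} → (∀ v → v ∈ V H → lookup v e ≡ s) → lookup X e ≡ s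
        constant⇒ {e} const with lookup X e ≟ˢ 𝟘
        ... | yes Xe≡𝟘 = contradiction const (not-constant Xe≡𝟘)
        ... | no Xe≢𝟘 = trans (sym (constant Xe≢𝟘 T T∈H)) (const T T∈H)

      isSignVectorOf : IsSignVectorOf H X
      isSignVectorOf = record
        { plus      = λ _ → constant⇒
        ; minus     = λ _ → constant⇒
        ; otherwise = λ e ¬+ ¬- → otherwise e ¬+ ¬-
        }
        where
        otherwise : ∀ e → ¬ (∀ v → v ∈ V H → lookup v e ≡ +) →
                    ¬ (∀ v → v ∈ V H → lookup v e ≡ -) → lookup X e ≡ 𝟘
        otherwise e ¬+ ¬- with lookup X e | constant {e}
        ... | + | const = contradiction (const λ ()) ¬+
        ... | - | const = contradiction (const λ ()) ¬-
        ... | 𝟘 | _     = refl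

      -- `H` is constant at `e` exactly when `X` is nonzero there, so the value of `X` at `e`
      -- decides which clause of `IsSignVectorOf` fires.
      signVector-unique : IsSignVectorOf H Y → Y ≡ X
      signVector-unique {Y} Y-sv = lookup-ext λ e → agree e
        where
        open IsSignVectorOf Y-sv
        agree : ∀ e → lookup Y e ≡ lookup X e
        agree e with lookup X e | constant {e} | not-constant {e}
        ... | + | const | _         = plus e (const λ ())
        ... | - | const | _         = minus e (const λ ())
        ... | 𝟘 | _     | not-const = otherwise e (not-const refl) (not-const refl)

    -- From antipodal subgraphs to covectors

    meet : SignVec n → SignVec n → SignVec n
    meet x y = tabulate λ e → if does (lookup x e ≟ˢ lookup y e) then lookup x e else 𝟘

    lookup-meet : ∀ x y e → (lookup x e ≡ lookup y e × lookup (meet x y) e ≡ lookup x e)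
                          ⊎ (lookup x e ≢ lookup y e × lookup (meet x y) e ≡ 𝟘)
    lookup-meet x y e with lookup x e ≟ˢ lookup y e
                         | lookup∘tabulate (λ e → if does (lookup x e ≟ˢ lookup y e) then lookup x e else 𝟘) e
    ... | yes eq | m = inj₁ (eq , m)
    ... | no neq | m = inj₂ (neq , m)

    meet-⊑ˡ : ∀ x y → meet x y ⊑ x
    meet-⊑ˡ x y e = [ inj₂ ∘ proj₂ , inj₁ ∘ proj₂ ]′ (lookup-meet x y e)

    meet-⊑ʳ : ∀ x y → meet x y ⊑ y
    meet-⊑ʳ x y e with lookup-meet x y e
    ... | inj₁ (eq , m) = inj₂ (trans m eq)
    ... | inj₂ (_ , m)  = inj₁ m

    ⊑-meet : ∀ X x y → X ⊑ x → X ⊑ y → X ⊑ meet x y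
    ⊑-meet _ x y X⊑x X⊑y e with lookup-meet x y e | X⊑x e | X⊑y e
    ... | _ | inj₁ Xe≡𝟘 | _ = inj₁ Xe≡𝟘
    ... | _ | _ | inj₁ Xe≡𝟘 = inj₁ Xe≡𝟘
    ... | inj₁ (_ , m) | inj₂ Xe≡xe | _ = inj₂ (trans Xe≡xe (sym m))
    ... | inj₂ (neq , _) | inj₂ Xe≡xe | inj₂ Xe≡ye = contradiction (trans (sym Xe≡xe) Xe≡ye) neq

    meet-between : ∀ x y z → NoZero x → NoZero y → NoZero z → meet x y ⊑ z → Between x z y
    meet-between x y z x-nz y-nz z-nz m⊑z e with lookup-meet x y e
    ... | inj₂ (neq , _) = two-nonzero (x-nz e) (y-nz e) (z-nz e) neq
    ... | inj₁ (_ , m) = inj₁ (trans (sym (⊑-nonzero (meet x y) z m⊑z (x-nz e ∘ trans (sym m)))) m)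

    -- The face of `meet x y` is convex and contains `x` and `y`, hence their hull. Conversely each
    -- tope of it lies between `x` and `y`, hence in every convex subgraph containing both.
    conv-face : ∀ {H} → IsConv G (｛ x ｝ ∪ ｛ y ｝) H → V H ≐ V (face (meet x y))
    conv-face {x} {y} {H} H-conv = _≤ᴳ_.vertices H≤face , λ {z} (z∈G , m⊑z) →
        convex-between convex x∈H y∈H (proj₂ z∈G)
          (meet-between x y z (proj₁ (inG x∈H)) (proj₁ (inG y∈H)) (proj₁ z∈G) m⊑z)
      where
      open IsConv H-conv

      x∈H : x ∈ V H
      x∈H = contains (inj₁ refl)

      y∈H : y ∈ V H
      y∈H = contains (inj₂ refl)

      inG : ∀ {v} → v ∈ V H → v ∈ V G
      inG = _≤ᴳ_.vertices (Convex.subgraph convex)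

      H≤face : H ≤ᴳ face (meet x y)
      H≤face = smallest (face (meet x y)) (face-convex (meet x y)) λ where
        (inj₁ refl) → inG x∈H , meet-⊑ˡ x y
        (inj₂ refl) → inG y∈H , meet-⊑ʳ x y

    -- The covector is the `meet` of any one vertex and its antipode; the antipodes of all the
    -- vertices provide the symmetry demanded by `covector`.
    antipodal⇒covector : ∀ {H} → Antipodal G H → ∃[ X ] X ∈ 𝓛 M × V H ≐ V (face X)
    antipodal⇒covector {H} H-antipodal with Antipodal.nonempty H-antipodal
    ... | x , x∈H with Antipodal.antipode H-antipodal x∈H
    ...   | y , y∈H , H-conv = S , covector (proj₂ (inG x∈H)) (meet-⊑ˡ x y) symmetric , H≐face
      where
      S : SignVec n
      S = meet x y

      H≐face : V H ≐ V (face S)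
      H≐face = conv-face H-conv

      inG : ∀ {v} → v ∈ V H → v ∈ V G
      inG = _≤ᴳ_.vertices (Antipodal.subgraph H-antipodal)

      symmetric : ∀ {T} → T ∈ 𝓣 M → S ⊑ T → S ⊚ ⊝ T ∈ 𝓣 M
      symmetric {T} T∈𝓣 S⊑T with Antipodal.antipode H-antipodal (proj₂ H≐face (vertex T∈𝓣 , S⊑T))
      ... | W , W∈H , TW-conv = subst (𝓣 M) (lookup-ext opposite) (proj₂ (inG W∈H))
        where
        m⊑ : ∀ {v} → v ∈ V H → meet T W ⊑ v
        m⊑ v∈H = proj₂ (proj₁ (conv-face TW-conv) v∈H)

        -- `H` is the face of `meet T W` as well, so `x` and `y` are above `meet T W`, and hence so
        -- is `S`. A zero of `S` is then a zero of `meet T W`, which means that `T` and `W` differ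
        -- there.
        m⊑S : meet T W ⊑ S
        m⊑S = ⊑-meet (meet T W) x y (m⊑ x∈H) (m⊑ y∈H)

        opposite : ∀ e → lookup W e ≡ lookup (S ⊚ ⊝ T) e
        opposite e with lookup S e ≟ˢ 𝟘
        ... | no Se≢𝟘 = trans (sym (⊑-nonzero S W (proj₂ (proj₁ H≐face W∈H)) Se≢𝟘))
                          (sym (lookup-⊚-nonzeroˡ S (⊝ T) Se≢𝟘))
        ... | yes Se≡𝟘 = trans (apart⇒neg (proj₂ T∈𝓣 e) (proj₁ (inG W∈H) e) Te≢We)
                           (sym (lookup-⊚⊝-zeroˡ S T Se≡𝟘))
          where
          Te≢We : lookup T e ≢ lookup W e
          Te≢We Te≡We with lookup-meet T W e
          ... | inj₂ (neq , _) = neq Te≡We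
          ... | inj₁ (_ , m) = proj₂ T∈𝓣 e (trans (sym m)
                  (trans (⊑-nonzero (meet T W) S m⊑S (proj₂ T∈𝓣 e ∘ trans (sym m))) Se≡𝟘))

    -- Covectors as sign vectors of antipodal and gated subgraphs

    antipodal⇒gated : ∀ H → Antipodal G H → Gated G H
    antipodal⇒gated H H-antipodal = conclude (antipodal⇒covector H-antipodal)
      where
      conclude : ∃[ X ] X ∈ 𝓛 M × V H ≐ V (face X) → Gated G H
      conclude (X , X∈𝓛 , H≐face) = gated X H (Antipodal.subgraph H-antipodal) X∈𝓛 H≐face

    covector⇒signVector : X ∈ 𝓛 M → X ∈ SignVectors (λ H → Antipodal G H × Gated G H)
    covector⇒signVector {X} X∈𝓛 = face X , (antipodal , antipodal⇒gated (face X) antipodal)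
      , isSignVectorOf X X∈𝓛 (face X) ((λ v∈ → v∈) , (λ v∈ → v∈))
      where
      antipodal : Antipodal G (face X)
      antipodal = face-antipodal X∈𝓛

    signVector⇒covector : X ∈ SignVectors (λ H → Antipodal G H) → X ∈ 𝓛 M
    signVector⇒covector {X} (H , H-antipodal , X-sv) = conclude (antipodal⇒covector H-antipodal)
      where
      conclude : ∃[ Y ] Y ∈ 𝓛 M × V H ≐ V (face Y) → X ∈ 𝓛 M
      conclude (Y , Y∈𝓛 , H≐face) = subst (𝓛 M) (sym (signVector-unique Y Y∈𝓛 H H≐face X-sv)) Y∈𝓛

mainTheorem2 : ∀ (n : ℕ) .{{_ : NonZero n}} (M : COM n) → Simple M →
    let G = topeGraph M in
    (𝓛 M ≐ SignVectors (λ H → Antipodal G H))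
    × (SignVectors (λ H → Antipodal G H) ≐ SignVectors (λ H → Antipodal G H × Gated G H))
    × (SignVectors (λ H → Antipodal G H × Gated G H) ≐ 𝓛ᴳ G)
    × (∀ H → Antipodal G H → Gated G H)
mainTheorem2 n M simple =
    (forget ∘ covector⇒signVector M simple , signVector⇒covector M simple)
  , ((λ (H , H-antipodal , X-sv) → H , (H-antipodal , antipodal⇒gated M simple H H-antipodal) , X-sv) , forget)
  , ( (λ X∈SV Y Y∈G → vertex M (⊚⊝-tope M (signVector⇒covector M simple (forget X∈SV)) (proj₂ Y∈G)))
    -- Membership in `𝓛ᴳ` would be vacuous without a tope; `tope` supplies one.
    , covector⇒signVector M simple ∘ 𝓛ᴳ⇒covector M (proj₂ (tope M simple)))
  , antipodal⇒gated M simple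
  where
  forget : ∀ {X} → X ∈ SignVectors (λ H → Antipodal (topeGraph M) H × Gated (topeGraph M) H) →
           X ∈ SignVectors (λ H → Antipodal (topeGraph M) H)
  forget (H , (H-antipodal , _) , X-sv) = H , H-antipodal , X-sv
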